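{- Let $k\in\mathbb{Z}$, let $m\in\mathbb{N}$ be odd and let $p>1$ be an odd integer. With $$S_{p}^{(k)}(1,m)=m^{p}T_{p}^{(k)}(1,m)-2\sum_{\nu=0}^{p}\binom{p}{\nu}E_{\nu}^{(k)}E_{p+1-\nu}m^{\nu-1},$$ we have $$S_{p}^{(k)}(1,m)=\sum_{i=1}^{p-2}\sum_{\nu=0}^{p-i}\binom{p}{\nu}\binom{p-\nu+1}{i}E_{\nu}^{(k)}E_{i}m^{p-i}+(p+1)E_{p}+m^{p}E_{p}^{(k)}(1).$$ Equivalently, $$m^{p}T_{p}^{(k)}(1,m)=\sum_{i=1}^{p-2}\sum_{\nu=0}^{p-i}\binom{p}{\nu}\binom{p-\nu+1}{i}E_{\nu}^{(k)}E_{i}m^{p-i}+(p+1)E_{p}+m^{p}E_{p}^{(k)}(1)+2\sum_{\nu=0}^{p}\binom{p}{\nu}E_{\nu}^{(k)}E_{p+1-\nu}m^{\nu-1}.$$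
   Context: Euler polynomials: $\frac{2}{e^t+1}e^{xt}=\sum_{n\ge0}E_n(x)\frac{t^n}{n!}$; Euler numbers $E_n=E_n(0)$. For $k\in\mathbb{Z}$, $\mathrm{Ei}_k(x)=\sum_{n=1}^{\infty}\frac{x^n}{n^k (n-1)!}$; poly-Genocchi polynomials: $\frac{2\,\mathrm{Ei}_k(\log(1+t))}{e^t+1}e^{xt}=\sum_{n\ge0}G_n^{(k)}(x)\frac{t^n}{n!}$; poly-Euler polynomials $E_n^{(k)}(x)=\frac{G_{n+1}^{(k)}(x)}{n+1}$ ($n\ge0$), with $E_n^{(k)}=E_n^{(k)}(0)$. The poly-Euler functions are $\overline{E}_p^{(k)}(x)=E_p^{(k)}(x-[x])$, where $[x]$ is the greatest integer $\le x$. For $h,m,p\in\mathbb{N}$ the poly-Dedekind type DC sums are $T_p^{(k)}(h,m)=2\sum_{\mu=1}^{m-1}(-1)^{\mu}\frac{\mu}{m}\overline{E}_p^{(k)}\big(\frac{h\mu}{m}\big)$. -}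

module Defs where

open import Data.Nat as ℕ using (ℕ; zero; suc)
import Data.Nat.Properties as ℕP
open import Data.Nat.Combinatorics using (_C_)
open import Data.Integer as ℤ using (ℤ; +_; -[1+_])
open import Data.Rational as ℚ using (ℚ; 0ℚ; 1ℚ; floor)
open import Data.List using (List; []; _∷_; _++_; length)

ℕtoℚ : ℕ → ℚ
ℕtoℚ n = (+ n) ℚ./ 1

ℤtoℚ : ℤ → ℚ
ℤtoℚ z = z ℚ./ 1

binom : ℕ → ℕ → ℚ
binom n j = ℕtoℚ (n C j)

_^ℚ_ : ℚ → ℕ → ℚ
x ^ℚ zero  = 1ℚ
x ^ℚ suc n = x ℚ.* (x ^ℚ n)

-- n ^ z for a natural base n ≥ 1 and an integer exponent z
-- (the value for n = 0 is a junk value and is never used below)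
natZPow : ℕ → ℤ → ℚ
natZPow zero    _          = 0ℚ
natZPow (suc n) (+ j)      = ℕtoℚ (suc n ℕ.^ j)
natZPow (suc n) -[1+ j ]   =
  ℚ._/_ (+ 1) (suc n ℕ.^ suc j) {{ℕP.m^n≢0 (suc n) (suc j)}}

-- a / m as a rational (junk value 0 for m = 0, never used below)
fracℚ : ℕ → ℕ → ℚ
fracℚ a zero    = 0ℚ
fracℚ a (suc n) = (+ a) ℚ./ suc n

sgn : ℕ → ℚ
sgn zero    = 1ℚ
sgn (suc n) = ℚ.- sgn n

-- Σ_{i = a}^{b} f i  (empty, i.e. 0, when b < a)
sumFrom : ℕ → ℕ → (ℕ → ℚ) → ℚ
sumFrom a zero    f = 0ℚ
sumFrom a (suc n) f = sumFrom a n f ℚ.+ f (a ℕ.+ n)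
-- sumFrom a n f = f a + f (a+1) + ... + f (a+n-1)

Σ[_⋯_] : ℕ → ℕ → (ℕ → ℚ) → ℚ
Σ[ a ⋯ b ] f = sumFrom a (suc b ℕ.∸ a) f

-- Euler numbers E_n = E_n(0):  2/(e^t+1) = Σ E_n t^n/n!.
-- Comparing coefficients in (e^t + 1) · Σ E_n t^n/n! = 2 gives
--   E_n + Σ_{j=0}^{n} C(n,j) E_j = 2 [n = 0],
-- i.e. E_0 = 1 and E_n = -(1/2) Σ_{j=0}^{n-1} C(n,j) E_j for n ≥ 1.

nth : List ℚ → ℕ → ℚ
nth []       _       = 0ℚ
nth (x ∷ xs) zero    = x
nth (x ∷ xs) (suc i) = nth xs i

eulerList : ℕ → List ℚ
eulerList zero    = 1ℚ ∷ []
eulerList (suc n) =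
  let xs = eulerList n in
  xs ++ ((ℚ.- ℚ.½) ℚ.* Σ[ 0 ⋯ n ] (λ j → binom (suc n) j ℚ.* nth xs j) ∷ [])

eulerNum : ℕ → ℚ
eulerNum n = nth (eulerList n) n

-- Euler polynomials: 2 e^{xt}/(e^t+1) = (Σ E_l t^l/l!)(Σ x^j t^j/j!), so
--   E_n(x) = Σ_{l=0}^{n} C(n,l) E_l x^{n-l}.
eulerPoly : ℕ → ℚ → ℚ
eulerPoly n x = Σ[ 0 ⋯ n ] (λ l → binom n l ℚ.* eulerNum l ℚ.* (x ^ℚ (n ℕ.∸ l)))

-- Signed Stirling numbers of the first kind s(n,j):
--   (log(1+t))^j / j! = Σ_n s(n,j) t^n/n!.
stirling1 : ℕ → ℕ → ℤ
stirling1 zero    zero    = + 1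
stirling1 zero    (suc j) = + 0
stirling1 (suc n) zero    = + 0
stirling1 (suc n) (suc j) = stirling1 n j ℤ.- (+ n) ℤ.* stirling1 n (suc j)

-- Coefficients of Ei_k(log(1+t)) = Σ_n a_n^{(k)} t^n/n!.
-- Since Ei_k(x) = Σ_{j≥1} x^j/(j^k (j-1)!) = Σ_{j≥1} j^{1-k} x^j/j!,
--   a_n^{(k)} = Σ_{j=1}^{n} j^{1-k} s(n,j).
eiLogCoeff : ℤ → ℕ → ℚ
eiLogCoeff k n = Σ[ 1 ⋯ n ] (λ j → natZPow j (+ 1 ℤ.- k) ℚ.* ℤtoℚ (stirling1 n j))

-- Poly-Genocchi polynomials:
--   2 Ei_k(log(1+t)) e^{xt}/(e^t+1) = Σ G_n^{(k)}(x) t^n/n!, hence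
--   G_n^{(k)}(x) = Σ_{j=0}^{n} C(n,j) a_j^{(k)} E_{n-j}(x).
polyGenocchi : ℤ → ℕ → ℚ → ℚ
polyGenocchi k n x =
  Σ[ 0 ⋯ n ] (λ j → binom n j ℚ.* eiLogCoeff k j ℚ.* eulerPoly (n ℕ.∸ j) x)

polyEulerPoly : ℤ → ℕ → ℚ → ℚ
polyEulerPoly k n x = polyGenocchi k (suc n) x ℚ.* ((+ 1) ℚ./ suc n)

polyEulerNum : ℤ → ℕ → ℚ
polyEulerNum k n = polyEulerPoly k n 0ℚ

polyEulerFun : ℤ → ℕ → ℚ → ℚ
polyEulerFun k p x = polyEulerPoly k p (x ℚ.- ℤtoℚ (floor x))

T : ℤ → ℕ → ℕ → ℕ → ℚ
T k p h m = ℕtoℚ 2 ℚ.* Σ[ 1 ⋯ m ℕ.∸ 1 ]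
  (λ μ → sgn μ ℚ.* fracℚ μ m ℚ.* polyEulerFun k p (fracℚ (h ℕ.* μ) m))

S : ℤ → ℕ → ℕ → ℚ
S k p m = (ℕtoℚ m ^ℚ p) ℚ.* T k p 1 m
  ℚ.- ℕtoℚ 2 ℚ.* Σ[ 0 ⋯ p ] (λ ν → binom p ν ℚ.* polyEulerNum k ν
        ℚ.* eulerNum (suc p ℕ.∸ ν) ℚ.* natZPow m ((+ ν) ℤ.- (+ 1)))

-- Exponential generating functions are encoded by their coefficient sequences f n / n! under the
-- Cauchy product. In this language the Euler polynomials form an Appell sequence with
-- E_n(x+1) + E_n(x) = 2xⁿ, which telescopes for odd m to 2 Σ_{μ<m} (-1)^μ μⁿ = E_n(m) + E_n,
-- and E_{2j} = 0 for j ≥ 1 because Ê(-t) = eᵗ Ê(t). The poly-Euler polynomials are Appell too: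
-- E_p^{(k)}(x) = Σ_ν C(p,ν) E_ν^{(k)} x^{p-ν}. Substituting this into m^p T_p^{(k)}(1,m), exchanging
-- the sums and evaluating the alternating power sums gives Σ_ν C(p,ν) E_ν^{(k)} m^{ν-1}
-- (E_{p+1-ν}(m) + E_{p+1-ν}); expanding E_{p+1-ν}(m) binomially cancels the subtracted part of S and
-- leaves a double sum over (ν, i). Its columns i = 0 and i = p give m^p E_p^{(k)}(1) and (p+1) E_p,
-- and the column i = p - 1 vanishes because E_{p-1} = 0 for odd p.

module Submission where

open import Data.Nat as ℕ using (ℕ; zero; suc; _<_; _%_; _∸_; s≤s; _!; NonZero)
import Data.Nat.Properties as ℕP
open import Data.Integer as ℤ using (ℤ; +_; -[1+_])
import Data.Integer.Properties as ℤP
import Data.Integer.Tactic.RingSolver as ℤ-Solver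
open import Data.Rational as ℚ using (ℚ; mkℚ; 0ℚ; 1ℚ; _+_; _*_; -_; _-_; floor)
import Data.Rational.Properties as ℚP
import Data.Rational.Unnormalised as ℚᵘ
import Data.Rational.Unnormalised.Properties as ℚᵘP
open import Data.Nat.Combinatorics using (_C_; nCn≡1; nC1≡n; nCk≡nC[n∸k]; k![n∸k]!∣n!)
open import Data.Nat.Combinatorics.Specification using (nCk≡n!/k![n-k]!)
open import Data.Nat.DivMod using (_/_; m/n*n≡m; m<n⇒m/n≡0; m≡m%n+[m/n]*n)
open import Data.Integer.DivMod using (div-pos-is-/ℕ)
open import Data.Fin using (Fin; toℕ)
open import Data.List using ([]; _∷_; _++_; length)
import Data.List.Properties as ListP
open import Data.Product using (∃; _,_; proj₂)
open import Data.Sum using (inj₁; inj₂)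
open import Algebra.Bundles using (CommutativeRing)
open import Algebra.Properties.CommutativeSemiring.Binomial (CommutativeRing.commutativeSemiring ℚP.+-*-commutativeRing)
  as Binomial using (binomialExpansion)
open import Algebra.Properties.Semiring.Exp (CommutativeRing.semiring ℚP.+-*-commutativeRing) using (_^_)
open import Algebra.Properties.Semiring.Mult (CommutativeRing.semiring ℚP.+-*-commutativeRing) using (_×_)
open import Algebra.Properties.Monoid.Sum ℚP.+-0-monoid using (sum; sum-cong-≋)
open import Algebra.Properties.Group ℚP.+-0-group using (∙-cancelˡ)
open import Relation.Nullary.Decidable.Core using (dec⇒maybe)
open import Tactic.RingSolver using (solve-∀)
open import Tactic.RingSolver.Core.AlmostCommutativeRing using (AlmostCommutativeRing; fromCommutativeRing)
open import Relation.Binary.PropositionalEquality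
open ≡-Reasoning

open import Defs

cong₃ : ∀ {A B C D : Set} (f : A → B → C → D) {a a′ b b′ c c′} →
        a ≡ a′ → b ≡ b′ → c ≡ c′ → f a b c ≡ f a′ b′ c′
cong₃ f refl refl refl = refl

ℚ-ring : AlmostCommutativeRing _ _
ℚ-ring = fromCommutativeRing ℚP.+-*-commutativeRing (λ x → dec⇒maybe (0ℚ ℚP.≟ x))

-- Definitionally equal to the constant ℕtoℚ 2 in T and S.
two : ℚ
two = 1ℚ + 1ℚ

*-two-injective : ∀ {x y} → x * two ≡ y * two → x ≡ y
*-two-injective {x} {y} eq = begin
  x              ≡⟨ halve x ⟩
  x * two * ℚ.½  ≡⟨ cong (_* ℚ.½) eq ⟩
  y * two * ℚ.½  ≡⟨ halve y ⟨
  y              ∎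
  where
  halve : ∀ z → z ≡ z * two * ℚ.½
  halve = solve-∀ ℚ-ring

-- Identities between normalised rationals are checked on their unnormalised images.
toℚᵘ-/ : ∀ i d → ℚ.toℚᵘ (i ℚ./ suc d) ℚᵘ.≃ ℚᵘ.mkℚᵘ i d
toℚᵘ-/ i d = ℚP.toℚᵘ-fromℚᵘ (ℚᵘ.mkℚᵘ i d)

≡-via-ℚᵘ : ∀ {p q : ℚ} {u v : ℚᵘ.ℚᵘ} →
           ℚ.toℚᵘ p ℚᵘ.≃ u → ℚ.toℚᵘ q ℚᵘ.≃ v → u ℚᵘ.≃ v → p ≡ q
≡-via-ℚᵘ p≃u q≃v u≃v = ℚP.toℚᵘ-injective (ℚᵘP.≃-trans p≃u (ℚᵘP.≃-trans u≃v (ℚᵘP.≃-sym q≃v)))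

toℚᵘ-+ : ∀ p q {u v} → ℚ.toℚᵘ p ℚᵘ.≃ u → ℚ.toℚᵘ q ℚᵘ.≃ v → ℚ.toℚᵘ (p + q) ℚᵘ.≃ u ℚᵘ.+ v
toℚᵘ-+ p q p≃u q≃v = ℚᵘP.≃-trans (ℚP.toℚᵘ-homo-+ p q) (ℚᵘP.+-cong p≃u q≃v)

toℚᵘ-* : ∀ p q {u v} → ℚ.toℚᵘ p ℚᵘ.≃ u → ℚ.toℚᵘ q ℚᵘ.≃ v → ℚ.toℚᵘ (p * q) ℚᵘ.≃ u ℚᵘ.* v
toℚᵘ-* p q p≃u q≃v = ℚᵘP.≃-trans (ℚP.toℚᵘ-homo-* p q) (ℚᵘP.*-cong p≃u q≃v)

ℕtoℚ-+ : ∀ a b → ℕtoℚ (a ℕ.+ b) ≡ ℕtoℚ a + ℕtoℚ b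
ℕtoℚ-+ a b = ≡-via-ℚᵘ (toℚᵘ-/ (+ (a ℕ.+ b)) 0)
  (toℚᵘ-+ (ℕtoℚ a) (ℕtoℚ b) (toℚᵘ-/ (+ a) 0) (toℚᵘ-/ (+ b) 0))
  (ℚᵘ.*≡* (trans (cong (ℤ._* + 1) (ℤP.pos-+ a b)) (unit-denominators (+ a) (+ b))))
  where
  unit-denominators : ∀ x y → (x ℤ.+ y) ℤ.* + 1 ≡ (x ℤ.* + 1 ℤ.+ y ℤ.* + 1) ℤ.* + 1
  unit-denominators = ℤ-Solver.solve-∀

ℕtoℚ-* : ∀ a b → ℕtoℚ (a ℕ.* b) ≡ ℕtoℚ a * ℕtoℚ b
ℕtoℚ-* a b = ≡-via-ℚᵘ (toℚᵘ-/ (+ (a ℕ.* b)) 0)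
  (toℚᵘ-* (ℕtoℚ a) (ℕtoℚ b) (toℚᵘ-/ (+ a) 0) (toℚᵘ-/ (+ b) 0))
  (ℚᵘ.*≡* (cong (ℤ._* + 1) (ℤP.pos-* a b)))

ℕtoℚ-suc : ∀ n → ℕtoℚ (suc n) ≡ ℕtoℚ n + 1ℚ
ℕtoℚ-suc n = trans (cong ℕtoℚ (ℕP.+-comm 1 n)) (ℕtoℚ-+ n 1)

^ℚ-+ : ∀ x a b → x ^ℚ (a ℕ.+ b) ≡ x ^ℚ a * x ^ℚ b
^ℚ-+ x zero    b = sym (ℚP.*-identityˡ _)
^ℚ-+ x (suc a) b = trans (cong (x *_) (^ℚ-+ x a b)) (sym (ℚP.*-assoc x _ _))

*-^ℚ : ∀ x y n → (x * y) ^ℚ n ≡ x ^ℚ n * y ^ℚ n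
*-^ℚ x y zero    = refl
*-^ℚ x y (suc n) = trans (cong ((x * y) *_) (*-^ℚ x y n)) (interchange x y _ _)
  where
  interchange : ∀ a b c d → (a * b) * (c * d) ≡ (a * c) * (b * d)
  interchange = solve-∀ ℚ-ring

1^ℚ : ∀ n → 1ℚ ^ℚ n ≡ 1ℚ
1^ℚ zero    = refl
1^ℚ (suc n) = trans (ℚP.*-identityˡ _) (1^ℚ n)

0^ℚsuc : ∀ n → 0ℚ ^ℚ suc n ≡ 0ℚ
0^ℚsuc n = ℚP.*-zeroˡ (0ℚ ^ℚ n)

ℕtoℚ-^ : ∀ m j → ℕtoℚ (m ℕ.^ j) ≡ ℕtoℚ m ^ℚ j
ℕtoℚ-^ m zero    = refl
ℕtoℚ-^ m (suc j) = trans (ℕtoℚ-* m (m ℕ.^ j)) (cong (ℕtoℚ m *_) (ℕtoℚ-^ m j))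

sgn-+ : ∀ a b → sgn (a ℕ.+ b) ≡ sgn a * sgn b
sgn-+ zero    b = sym (ℚP.*-identityˡ _)
sgn-+ (suc a) b = trans (cong -_ (sgn-+ a b)) (ℚP.neg-distribˡ-* (sgn a) (sgn b))

sgn≡-1^ℚ : ∀ n → sgn n ≡ (- 1ℚ) ^ℚ n
sgn≡-1^ℚ zero    = refl
sgn≡-1^ℚ (suc n) = trans (cong -_ (sgn≡-1^ℚ n)) (neg≡-1* _)
  where
  neg≡-1* : ∀ x → - x ≡ - 1ℚ * x
  neg≡-1* = solve-∀ ℚ-ring

double : ℕ → ℕ
double zero    = zero
double (suc n) = suc (suc (double n))

sgn-double : ∀ n → sgn (double n) ≡ 1ℚ
sgn-double zero    = refl
sgn-double (suc n) = trans (neg-involutive (sgn (double n))) (sgn-double n)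
  where
  neg-involutive : ∀ x → - - x ≡ x
  neg-involutive = solve-∀ ℚ-ring

Σ< : ℕ → (ℕ → ℚ) → ℚ
Σ< = sumFrom 0

sumFrom-shift : ∀ a n f → sumFrom a n f ≡ Σ< n (λ i → f (a ℕ.+ i))
sumFrom-shift a zero    f = refl
sumFrom-shift a (suc n) f = cong (_+ f (a ℕ.+ n)) (sumFrom-shift a n f)

Σ-cong : ∀ n {f g : ℕ → ℚ} → (∀ i → i < n → f i ≡ g i) → Σ< n f ≡ Σ< n g
Σ-cong zero    eq = refl
Σ-cong (suc n) eq = cong₂ _+_ (Σ-cong n (λ i i<n → eq i (ℕP.m<n⇒m<1+n i<n))) (eq n (ℕP.n<1+n n))

Σ-cong′ : ∀ n {f g : ℕ → ℚ} → f ≗ g → Σ< n f ≡ Σ< n g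
Σ-cong′ n eq = Σ-cong n (λ i _ → eq i)

Σ-zero : ∀ n f → (∀ i → i < n → f i ≡ 0ℚ) → Σ< n f ≡ 0ℚ
Σ-zero zero    f eq = refl
Σ-zero (suc n) f eq = begin
  Σ< n f + f n  ≡⟨ cong₂ _+_ (Σ-zero n f (λ i i<n → eq i (ℕP.m<n⇒m<1+n i<n))) (eq n (ℕP.n<1+n n)) ⟩
  0ℚ + 0ℚ       ≡⟨ ℚP.+-identityʳ 0ℚ ⟩
  0ℚ            ∎

Σ-distrib-+ : ∀ n f g → Σ< n (λ i → f i + g i) ≡ Σ< n f + Σ< n g
Σ-distrib-+ zero    f g = refl
Σ-distrib-+ (suc n) f g =
  trans (cong (_+ (f n + g n)) (Σ-distrib-+ n f g)) (interchange (Σ< n f) (Σ< n g) (f n) (g n))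
  where
  interchange : ∀ a b c d → (a + b) + (c + d) ≡ (a + c) + (b + d)
  interchange = solve-∀ ℚ-ring

*-distribˡ-Σ : ∀ n c f → c * Σ< n f ≡ Σ< n (λ i → c * f i)
*-distribˡ-Σ zero    c f = ℚP.*-zeroʳ c
*-distribˡ-Σ (suc n) c f = trans (ℚP.*-distribˡ-+ c _ _) (cong (_+ c * f n) (*-distribˡ-Σ n c f))

*-distribʳ-Σ : ∀ n c f → Σ< n f * c ≡ Σ< n (λ i → f i * c)
*-distribʳ-Σ n c f =
  trans (ℚP.*-comm _ c) (trans (*-distribˡ-Σ n c f) (Σ-cong′ n (λ i → ℚP.*-comm c (f i))))

neg-distrib-Σ : ∀ n f → - Σ< n f ≡ Σ< n (λ i → - f i)
neg-distrib-Σ zero    f = refl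
neg-distrib-Σ (suc n) f = trans (ℚP.neg-distrib-+ (Σ< n f) (f n)) (cong (_+ - f n) (neg-distrib-Σ n f))

Σ-suc : ∀ n f → Σ< (suc n) f ≡ f 0 + Σ< n (λ i → f (suc i))
Σ-suc zero    f = trans (ℚP.+-identityˡ (f 0)) (sym (ℚP.+-identityʳ (f 0)))
Σ-suc (suc n) f = trans (cong (_+ f (suc n)) (Σ-suc n f)) (ℚP.+-assoc (f 0) _ _)

Σ-reverse : ∀ n f → Σ< (suc n) f ≡ Σ< (suc n) (λ j → f (n ∸ j))
Σ-reverse zero    f = refl
Σ-reverse (suc n) f = begin
  Σ< (suc n) f + f (suc n)                       ≡⟨ cong (_+ f (suc n)) (Σ-reverse n f) ⟩
  Σ< (suc n) (λ j → f (n ∸ j)) + f (suc n)       ≡⟨ ℚP.+-comm _ (f (suc n)) ⟩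
  f (suc n) + Σ< (suc n) (λ j → f (n ∸ j))       ≡⟨ Σ-suc (suc n) (λ j → f (suc n ∸ j)) ⟨
  Σ< (suc (suc n)) (λ j → f (suc n ∸ j))         ∎

Σ-swap : ∀ n m (F : ℕ → ℕ → ℚ) → Σ< n (λ i → Σ< m (F i)) ≡ Σ< m (λ j → Σ< n (λ i → F i j))
Σ-swap zero    m F = sym (Σ-zero m _ (λ _ _ → refl))
Σ-swap (suc n) m F =
  trans (cong (_+ Σ< m (F n)) (Σ-swap n m F)) (sym (Σ-distrib-+ m (λ j → Σ< n (λ i → F i j)) (F n)))

-- Both sides sum F j l over the triangle j + l < M.
Σ-triangle : ∀ M (F : ℕ → ℕ → ℚ) →
  Σ< M (λ r → Σ< (suc r) (λ j → F j (r ∸ j))) ≡ Σ< M (λ j → Σ< (M ∸ j) (F j))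
Σ-triangle zero    F = refl
Σ-triangle (suc M) F = begin
    Σ< M (λ r → Σ< (suc r) (λ j → F j (r ∸ j))) + (Σ< M diagonal + F M (M ∸ M))
  ≡⟨ cong₂ (λ u v → u + (Σ< M diagonal + F M v)) (Σ-triangle M F) (ℕP.n∸n≡0 M) ⟩
    Σ< M (λ j → Σ< (M ∸ j) (F j)) + (Σ< M diagonal + F M 0)
  ≡⟨ regroup (Σ< M (λ j → Σ< (M ∸ j) (F j))) (Σ< M diagonal) (F M 0) ⟩
    (Σ< M (λ j → Σ< (M ∸ j) (F j)) + Σ< M diagonal) + (0ℚ + F M 0)
  ≡⟨ cong₂ _+_ (sym (Σ-distrib-+ M _ _)) (cong (λ z → Σ< z (F M)) (sym (ℕP.m+n∸n≡m 1 M))) ⟩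
    Σ< M (λ j → Σ< (M ∸ j) (F j) + diagonal j) + Σ< (suc M ∸ M) (F M)
  ≡⟨ cong (_+ Σ< (suc M ∸ M) (F M)) (Σ-cong M (λ j j<M →
       cong (λ z → Σ< z (F j)) (sym (ℕP.+-∸-assoc 1 (ℕP.<⇒≤ j<M))))) ⟩
    Σ< M (λ j → Σ< (suc M ∸ j) (F j)) + Σ< (suc M ∸ M) (F M)
  ∎
  where
  diagonal : ℕ → ℚ
  diagonal j = F j (M ∸ j)
  regroup : ∀ a b c → a + (b + c) ≡ (a + b) + (0ℚ + c)
  regroup = solve-∀ ℚ-ring

Σ-triangle-swap : ∀ M (F : ℕ → ℕ → ℚ) →
  Σ< M (λ j → Σ< (M ∸ j) (F j)) ≡ Σ< M (λ l → Σ< (M ∸ l) (λ j → F j l))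
Σ-triangle-swap M F = begin
    Σ< M (λ j → Σ< (M ∸ j) (F j))
  ≡⟨ Σ-triangle M F ⟨
    Σ< M (λ r → Σ< (suc r) (λ j → F j (r ∸ j)))
  ≡⟨ Σ-cong′ M (λ r → trans (Σ-reverse r (λ j → F j (r ∸ j)))
       (Σ-cong (suc r) (λ j j≤r → cong (F (r ∸ j)) (ℕP.m∸[m∸n]≡n (ℕP.≤-pred j≤r))))) ⟩
    Σ< M (λ r → Σ< (suc r) (λ l → F (r ∸ l) l))
  ≡⟨ Σ-triangle M (λ l j → F j l) ⟩
    Σ< M (λ l → Σ< (M ∸ l) (λ j → F j l))
  ∎

Seq : Set
Seq = ℕ → ℚ

infixl 6 _⊕_
infixl 7 _⊛_
infixr 8 _·_

_⊕_ : Seq → Seq → Seq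
(f ⊕ g) n = f n + g n

_·_ : ℚ → Seq → Seq
(c · f) n = c * f n

_⊛_ : Seq → Seq → Seq
(f ⊛ g) n = Σ< (suc n) (λ j → f j * g (n ∸ j))

δ : Seq
δ zero    = 1ℚ
δ (suc n) = 0ℚ

alternate : Seq → Seq
alternate f n = sgn n * f n

⊛-congˡ : ∀ g {f f′} → f ≗ f′ → f ⊛ g ≗ f′ ⊛ g
⊛-congˡ g eq n = Σ-cong′ (suc n) (λ j → cong (_* g (n ∸ j)) (eq j))

⊛-congʳ : ∀ f {g g′} → g ≗ g′ → f ⊛ g ≗ f ⊛ g′
⊛-congʳ f eq n = Σ-cong′ (suc n) (λ j → cong (f j *_) (eq (n ∸ j)))

⊛-comm : ∀ f g → f ⊛ g ≗ g ⊛ f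
⊛-comm f g n = trans (Σ-reverse n (λ j → f j * g (n ∸ j))) (Σ-cong (suc n) (λ j j<1+n →
  trans (cong (λ z → f (n ∸ j) * g z) (ℕP.m∸[m∸n]≡n (ℕP.≤-pred j<1+n))) (ℚP.*-comm (f (n ∸ j)) (g j))))

⊛-assoc : ∀ f g h → (f ⊛ g) ⊛ h ≗ f ⊛ (g ⊛ h)
⊛-assoc f g h n = begin
    Σ< (suc n) (λ r → (f ⊛ g) r * h (n ∸ r))
  ≡⟨ Σ-cong (suc n) (λ r r<1+n → trans (*-distribʳ-Σ (suc r) (h (n ∸ r)) _)
       (Σ-cong (suc r) (λ j j<1+r → cong (λ z → f j * g (r ∸ j) * h (n ∸ z))
          (sym (ℕP.m+[n∸m]≡n (ℕP.≤-pred j<1+r)))))) ⟩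
    Σ< (suc n) (λ r → Σ< (suc r) (λ j → F j (r ∸ j)))
  ≡⟨ Σ-triangle (suc n) F ⟩
    Σ< (suc n) (λ j → Σ< (suc n ∸ j) (F j))
  ≡⟨ Σ-cong (suc n) (λ j j<1+n → begin
       Σ< (suc n ∸ j) (F j)
     ≡⟨ cong (λ z → Σ< z (F j)) (ℕP.+-∸-assoc 1 (ℕP.≤-pred j<1+n)) ⟩
       Σ< (suc (n ∸ j)) (F j)
     ≡⟨ Σ-cong′ (suc (n ∸ j)) (λ l → trans (cong (λ z → f j * g l * h z) (sym (ℕP.∸-+-assoc n j l)))
          (ℚP.*-assoc (f j) (g l) (h (n ∸ j ∸ l)))) ⟩
       Σ< (suc (n ∸ j)) (λ l → f j * (g l * h (n ∸ j ∸ l)))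
     ≡⟨ *-distribˡ-Σ (suc (n ∸ j)) (f j) _ ⟨
       f j * (g ⊛ h) (n ∸ j)
     ∎) ⟩
    (f ⊛ (g ⊛ h)) n
  ∎
  where
  F : ℕ → ℕ → ℚ
  F j l = f j * g l * h (n ∸ (j ℕ.+ l))

⊛-identityʳ : ∀ f → f ⊛ δ ≗ f
⊛-identityʳ f n = begin
    Σ< n (λ j → f j * δ (n ∸ j)) + f n * δ (n ∸ n)
  ≡⟨ cong₂ _+_ (Σ-zero n _ (λ j j<n → trans (cong (λ z → f j * δ z) (ℕP.+-∸-assoc 1 j<n)) (ℚP.*-zeroʳ (f j))))
               (cong (λ z → f n * δ z) (ℕP.n∸n≡0 n)) ⟩
    0ℚ + f n * 1ℚ
  ≡⟨ trans (ℚP.+-identityˡ _) (ℚP.*-identityʳ (f n)) ⟩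
    f n
  ∎

⊛-identityˡ : ∀ f → δ ⊛ f ≗ f
⊛-identityˡ f n = trans (⊛-comm δ f n) (⊛-identityʳ f n)

⊛-distribʳ-⊕ : ∀ f g h → (f ⊕ g) ⊛ h ≗ f ⊛ h ⊕ g ⊛ h
⊛-distribʳ-⊕ f g h n =
  trans (Σ-cong′ (suc n) (λ j → ℚP.*-distribʳ-+ (h (n ∸ j)) (f j) (g j))) (Σ-distrib-+ (suc n) _ _)

⊛-distribˡ-⊕ : ∀ f g h → f ⊛ (g ⊕ h) ≗ f ⊛ g ⊕ f ⊛ h
⊛-distribˡ-⊕ f g h n = begin
  (f ⊛ (g ⊕ h)) n        ≡⟨ ⊛-comm f (g ⊕ h) n ⟩
  ((g ⊕ h) ⊛ f) n        ≡⟨ ⊛-distribʳ-⊕ g h f n ⟩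
  (g ⊛ f ⊕ h ⊛ f) n      ≡⟨ cong₂ _+_ (⊛-comm g f n) (⊛-comm h f n) ⟩
  (f ⊛ g ⊕ f ⊛ h) n      ∎

·-⊛ : ∀ c f g → c · f ⊛ g ≗ c · (f ⊛ g)
·-⊛ c f g n = trans (Σ-cong′ (suc n) (λ j → ℚP.*-assoc c (f j) (g (n ∸ j)))) (sym (*-distribˡ-Σ (suc n) c _))

⊛-suc : ∀ f g → f 0 ≡ 0ℚ → ∀ n → (f ⊛ g) (suc n) ≡ ((λ i → f (suc i)) ⊛ g) n
⊛-suc f g f0≡0 n = begin
    (f ⊛ g) (suc n)
  ≡⟨ Σ-suc (suc n) (λ j → f j * g (suc n ∸ j)) ⟩
    f 0 * g (suc n) + ((λ i → f (suc i)) ⊛ g) n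
  ≡⟨ cong (λ z → z * g (suc n) + ((λ i → f (suc i)) ⊛ g) n) f0≡0 ⟩
    0ℚ * g (suc n) + ((λ i → f (suc i)) ⊛ g) n
  ≡⟨ trans (cong (_+ ((λ i → f (suc i)) ⊛ g) n) (ℚP.*-zeroˡ (g (suc n)))) (ℚP.+-identityˡ _) ⟩
    ((λ i → f (suc i)) ⊛ g) n
  ∎

alternate-⊛ : ∀ f g → alternate (f ⊛ g) ≗ alternate f ⊛ alternate g
alternate-⊛ f g n = trans (*-distribˡ-Σ (suc n) (sgn n) _) (Σ-cong (suc n) (λ j j<1+n → begin
    sgn n * (f j * g (n ∸ j))
  ≡⟨ cong (λ z → sgn z * (f j * g (n ∸ j))) (sym (ℕP.m+[n∸m]≡n (ℕP.≤-pred j<1+n))) ⟩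
    sgn (j ℕ.+ (n ∸ j)) * (f j * g (n ∸ j))
  ≡⟨ cong (_* (f j * g (n ∸ j))) (sgn-+ j (n ∸ j)) ⟩
    sgn j * sgn (n ∸ j) * (f j * g (n ∸ j))
  ≡⟨ interchange (sgn j) (sgn (n ∸ j)) (f j) (g (n ∸ j)) ⟩
    sgn j * f j * (sgn (n ∸ j) * g (n ∸ j))
  ∎))
  where
  interchange : ∀ a b c d → (a * b) * (c * d) ≡ (a * c) * (b * d)
  interchange = solve-∀ ℚ-ring

alternate-δ : alternate δ ≗ δ
alternate-δ zero    = refl
alternate-δ (suc n) = ℚP.*-zeroʳ (sgn (suc n))

-- Compare coefficients from n = 0 upwards: once f and g agree below n,
-- (f ⊛ d) n and (g ⊛ d) n differ only in the term f n · d 0.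
⊛-cancelʳ : ∀ {f g} d {c} → d 0 * c ≡ 1ℚ → f ⊛ d ≗ g ⊛ d → f ≗ g
⊛-cancelʳ {f} {g} d {c} d0*c≡1 eq n = agreeBelow (suc n) n (ℕP.n<1+n n)
  where
  unit : ∀ x → x * d 0 * c ≡ x
  unit x = trans (ℚP.*-assoc x (d 0) c) (trans (cong (x *_) d0*c≡1) (ℚP.*-identityʳ x))
  lastTerm : ∀ h j → (h ⊛ d) j ≡ Σ< j (λ i → h i * d (j ∸ i)) + h j * d 0
  lastTerm h j = cong (λ z → Σ< j (λ i → h i * d (j ∸ i)) + h j * d z) (ℕP.n∸n≡0 j)
  agreeBelow : ∀ N j → j < N → f j ≡ g j
  agreeBelow (suc N) j j<1+N with ℕP.m<1+n⇒m<n∨m≡n j<1+N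
  ... | inj₁ j<N  = agreeBelow N j j<N
  ... | inj₂ refl = begin
    f j            ≡⟨ unit (f j) ⟨
    f j * d 0 * c  ≡⟨ cong (_* c) (∙-cancelˡ (Σ< j (λ i → f i * d (j ∸ i))) (f j * d 0) (g j * d 0) leading) ⟩
    g j * d 0 * c  ≡⟨ unit (g j) ⟩
    g j            ∎
    where
    lower : Σ< j (λ i → f i * d (j ∸ i)) ≡ Σ< j (λ i → g i * d (j ∸ i))
    lower = Σ-cong j (λ i i<j → cong (_* d (j ∸ i)) (agreeBelow j i i<j))
    leading : Σ< j (λ i → f i * d (j ∸ i)) + f j * d 0 ≡ Σ< j (λ i → f i * d (j ∸ i)) + g j * d 0
    leading = begin
      Σ< j (λ i → f i * d (j ∸ i)) + f j * d 0  ≡⟨ lastTerm f j ⟨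
      (f ⊛ d) j                                 ≡⟨ eq j ⟩
      (g ⊛ d) j                                 ≡⟨ lastTerm g j ⟩
      Σ< j (λ i → g i * d (j ∸ i)) + g j * d 0  ≡⟨ cong (_+ g j * d 0) lower ⟨
      Σ< j (λ i → f i * d (j ∸ i)) + g j * d 0  ∎

1/ℕ : (n : ℕ) → .{{NonZero n}} → ℚ
1/ℕ n = (+ 1) ℚ./ n

ℕtoℚ-*-1/ℕ : ∀ n .{{_ : NonZero n}} → ℕtoℚ n * 1/ℕ n ≡ 1ℚ
ℕtoℚ-*-1/ℕ (suc n) = ≡-via-ℚᵘ (toℚᵘ-* (ℕtoℚ (suc n)) (1/ℕ (suc n)) (toℚᵘ-/ (+ suc n) 0) (toℚᵘ-/ (+ 1) n))
  ℚᵘP.≃-refl (ℚᵘ.*≡* (trans (unit-denominators (+ suc n)) (cong (λ z → + 1 ℤ.* + z) (sym (ℕP.*-identityˡ (suc n))))))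
  where
  unit-denominators : ∀ x → (x ℤ.* + 1) ℤ.* + 1 ≡ + 1 ℤ.* x
  unit-denominators = ℤ-Solver.solve-∀

1/ℕ-* : ∀ a b .{{_ : NonZero a}} .{{_ : NonZero b}} → 1/ℕ a * 1/ℕ b ≡ (1/ℕ (a ℕ.* b)) {{ℕP.m*n≢0 a b}}
1/ℕ-* (suc a) (suc b) = ≡-via-ℚᵘ (toℚᵘ-* (1/ℕ (suc a)) (1/ℕ (suc b)) (toℚᵘ-/ (+ 1) a) (toℚᵘ-/ (+ 1) b))
  (toℚᵘ-/ (+ 1) (b ℕ.+ a ℕ.* suc b)) (ℚᵘ.*≡* refl)

fact : ℕ → ℚ
fact n = ℕtoℚ (n !)

invFact : ℕ → ℚ
invFact n = (1/ℕ (n !)) {{n ℕP.!≢0}}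

fact-*-invFact : ∀ n → fact n * invFact n ≡ 1ℚ
fact-*-invFact n = ℕtoℚ-*-1/ℕ (n !) {{n ℕP.!≢0}}

1/ℕ-suc-*-invFact : ∀ n → 1/ℕ (suc n) * invFact n ≡ invFact (suc n)
1/ℕ-suc-*-invFact n = 1/ℕ-* (suc n) (n !) {{_}} {{n ℕP.!≢0}}

binom≡fact*invFact*invFact : ∀ {n j} → j ℕ.≤ n → binom n j ≡ fact n * invFact j * invFact (n ∸ j)
binom≡fact*invFact*invFact {n} {j} j≤n = begin
    ℕtoℚ c
  ≡⟨ trans (cong₂ (λ u v → ℕtoℚ c * (u * v)) (fact-*-invFact j) (fact-*-invFact (n ∸ j)))
           (ℚP.*-identityʳ (ℕtoℚ c)) ⟨
    ℕtoℚ c * ((fact j * invFact j) * (fact (n ∸ j) * invFact (n ∸ j)))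
  ≡⟨ regroup (ℕtoℚ c) (fact j) (fact (n ∸ j)) (invFact j) (invFact (n ∸ j)) ⟩
    ℕtoℚ c * (fact j * fact (n ∸ j)) * invFact j * invFact (n ∸ j)
  ≡⟨ cong (λ z → z * invFact j * invFact (n ∸ j)) (begin
       ℕtoℚ c * (fact j * fact (n ∸ j))       ≡⟨ cong (ℕtoℚ c *_) (ℕtoℚ-* (j !) ((n ∸ j) !)) ⟨
       ℕtoℚ c * ℕtoℚ (j ! ℕ.* (n ∸ j) !)      ≡⟨ ℕtoℚ-* c (j ! ℕ.* (n ∸ j) !) ⟨
       ℕtoℚ (c ℕ.* (j ! ℕ.* (n ∸ j) !))       ≡⟨ cong ℕtoℚ C*fact*fact ⟩
       fact n                                 ∎) ⟩
    fact n * invFact j * invFact (n ∸ j)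
  ∎
  where
  c = n C j
  instance _ = j ℕP.!* (n ∸ j) !≢0
  C*fact*fact : c ℕ.* (j ! ℕ.* (n ∸ j) !) ≡ n !
  C*fact*fact = trans (cong (ℕ._* (j ! ℕ.* (n ∸ j) !)) (nCk≡n!/k![n-k]! j≤n)) (m/n*n≡m (k![n∸k]!∣n! j≤n))
  regroup : ∀ c a b ia ib → c * ((a * ia) * (b * ib)) ≡ (c * (a * b)) * ia * ib
  regroup = solve-∀ ℚ-ring

egf : Seq → Seq
egf f n = f n * invFact n

egf-injective : ∀ f g n → egf f n ≡ egf g n → f n ≡ g n
egf-injective f g n eq = trans (recover f) (trans (cong (_* fact n) eq) (sym (recover g)))
  where
  recover : ∀ h → h n ≡ egf h n * fact n
  recover h = sym (trans (ℚP.*-assoc (h n) (invFact n) (fact n))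
    (trans (cong (h n *_) (trans (ℚP.*-comm (invFact n) (fact n)) (fact-*-invFact n))) (ℚP.*-identityʳ (h n))))

binomialConv : Seq → Seq → Seq
binomialConv f g n = Σ< (suc n) (λ j → binom n j * f j * g (n ∸ j))

egf-binomialConv : ∀ f g → egf (binomialConv f g) ≗ egf f ⊛ egf g
egf-binomialConv f g n = trans (*-distribʳ-Σ (suc n) (invFact n) _) (Σ-cong (suc n) (λ j j<1+n → begin
    binom n j * f j * g (n ∸ j) * invFact n
  ≡⟨ cong (λ z → z * f j * g (n ∸ j) * invFact n) (binom≡fact*invFact*invFact (ℕP.≤-pred j<1+n)) ⟩
    fact n * invFact j * invFact (n ∸ j) * f j * g (n ∸ j) * invFact n
  ≡⟨ regroup (fact n) (invFact j) (invFact (n ∸ j)) (f j) (g (n ∸ j)) (invFact n) ⟩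
    (fact n * invFact n) * (egf f j * egf g (n ∸ j))
  ≡⟨ trans (cong (_* (egf f j * egf g (n ∸ j))) (fact-*-invFact n)) (ℚP.*-identityˡ _) ⟩
    egf f j * egf g (n ∸ j)
  ∎))
  where
  regroup : ∀ F I J A B K → F * I * J * A * B * K ≡ (F * K) * (A * I * (B * J))
  regroup = solve-∀ ℚ-ring

powers : ℚ → Seq
powers x n = x ^ℚ n

egf-powers-0 : egf (powers 0ℚ) ≗ δ
egf-powers-0 zero    = refl
egf-powers-0 (suc n) = trans (cong (_* invFact (suc n)) (0^ℚsuc n)) (ℚP.*-zeroˡ (invFact (suc n)))

⊛-egf-powers-0 : ∀ f → f ⊛ egf (powers 0ℚ) ≗ f
⊛-egf-powers-0 f n = trans (⊛-congʳ f egf-powers-0 n) (⊛-identityʳ f n)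

Σ<≡sum : ∀ n g → Σ< n g ≡ sum (λ (k : Fin n) → g (toℕ k))
Σ<≡sum zero    g = refl
Σ<≡sum (suc n) g = trans (Σ-suc n g) (cong (_+_ (g 0)) (Σ<≡sum n (λ i → g (suc i))))

×≡ℕtoℚ-* : ∀ m x → m × x ≡ ℕtoℚ m * x
×≡ℕtoℚ-* zero    x = sym (ℚP.*-zeroˡ x)
×≡ℕtoℚ-* (suc m) x = begin
  x + m × x            ≡⟨ cong (_+_ x) (×≡ℕtoℚ-* m x) ⟩
  x + ℕtoℚ m * x       ≡⟨ cong (_+ ℕtoℚ m * x) (ℚP.*-identityˡ x) ⟨
  1ℚ * x + ℕtoℚ m * x  ≡⟨ ℚP.*-distribʳ-+ x 1ℚ (ℕtoℚ m) ⟨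
  (1ℚ + ℕtoℚ m) * x    ≡⟨ cong (_* x) (trans (ℚP.+-comm 1ℚ (ℕtoℚ m)) (sym (ℕtoℚ-suc m))) ⟩
  ℕtoℚ (suc m) * x     ∎

^≡^ℚ : ∀ x n → x ^ n ≡ x ^ℚ n
^≡^ℚ x zero    = refl
^≡^ℚ x (suc n) = cong (x *_) (^≡^ℚ x n)

binomial-theorem : ∀ x y n → binomialConv (powers x) (powers y) n ≡ (x + y) ^ℚ n
binomial-theorem x y n = begin
    binomialConv (powers x) (powers y) n
  ≡⟨ Σ<≡sum (suc n) _ ⟩
    sum (λ (k : Fin (suc n)) → binom n (toℕ k) * x ^ℚ toℕ k * y ^ℚ (n ∸ toℕ k))
  ≡⟨ sum-cong-≋ {suc n} (λ k → term (toℕ k)) ⟩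
    binomialExpansion x y n
  ≡⟨ Binomial.theorem n x y ⟨
    (x + y) ^ n
  ≡⟨ ^≡^ℚ (x + y) n ⟩
    (x + y) ^ℚ n
  ∎
  where
  term : ∀ j → binom n j * x ^ℚ j * y ^ℚ (n ∸ j) ≡ (n C j) × (x ^ j * y ^ (n ∸ j))
  term j = begin
    binom n j * x ^ℚ j * y ^ℚ (n ∸ j)    ≡⟨ ℚP.*-assoc (binom n j) _ _ ⟩
    binom n j * (x ^ℚ j * y ^ℚ (n ∸ j))  ≡⟨ cong₂ (λ u v → binom n j * (u * v)) (^≡^ℚ x j) (^≡^ℚ y (n ∸ j)) ⟨
    binom n j * (x ^ j * y ^ (n ∸ j))    ≡⟨ ×≡ℕtoℚ-* (n C j) _ ⟨
    (n C j) × (x ^ j * y ^ (n ∸ j))      ∎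

egf-powers-+ : ∀ x y → egf (powers (x + y)) ≗ egf (powers x) ⊛ egf (powers y)
egf-powers-+ x y n = trans (cong (_* invFact n) (sym (binomial-theorem x y n))) (egf-binomialConv (powers x) (powers y) n)

egf-⊕ : ∀ f g → egf (f ⊕ g) ≗ egf f ⊕ egf g
egf-⊕ f g n = ℚP.*-distribʳ-+ (invFact n) (f n) (g n)

egf-· : ∀ c f → egf (c · f) ≗ c · egf f
egf-· c f n = ℚP.*-assoc c (f n) (invFact n)

egf-δ : egf δ ≗ δ
egf-δ zero    = refl
egf-δ (suc n) = ℚP.*-zeroˡ (invFact (suc n))

nth-++ˡ : ∀ xs ys i → i < length xs → nth (xs ++ ys) i ≡ nth xs i
nth-++ˡ (x ∷ xs) ys zero    _         = refl
nth-++ˡ (x ∷ xs) ys (suc i) (s≤s i<n) = nth-++ˡ xs ys i i<n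

nth-length : ∀ xs y → nth (xs ++ y ∷ []) (length xs) ≡ y
nth-length []       y = refl
nth-length (x ∷ xs) y = nth-length xs y

length-eulerList : ∀ n → length (eulerList n) ≡ suc n
length-eulerList zero    = refl
length-eulerList (suc n) =
  trans (ListP.length-++ (eulerList n)) (trans (cong (ℕ._+ 1) (length-eulerList n)) (ℕP.+-comm (suc n) 1))

nth-eulerList : ∀ n i → i ℕ.≤ n → nth (eulerList n) i ≡ eulerNum i
nth-eulerList zero    zero _   = refl
nth-eulerList (suc n) i i≤1+n with ℕP.m≤n⇒m<n∨m≡n i≤1+n
... | inj₁ i<1+n = trans (nth-++ˡ (eulerList n) _ i (subst (i <_) (sym (length-eulerList n)) i<1+n))
                         (nth-eulerList n i (ℕP.≤-pred i<1+n))
... | inj₂ refl  = refl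

eulerNum-suc : ∀ n → eulerNum (suc n) ≡ (- ℚ.½) * Σ< (suc n) (λ j → binom (suc n) j * eulerNum j)
eulerNum-suc n = begin
    nth (eulerList n ++ last ∷ []) (suc n)
  ≡⟨ cong (nth (eulerList n ++ last ∷ [])) (length-eulerList n) ⟨
    nth (eulerList n ++ last ∷ []) (length (eulerList n))
  ≡⟨ nth-length (eulerList n) last ⟩
    last
  ≡⟨ cong ((- ℚ.½) *_) (Σ-cong (suc n) (λ j j<1+n → cong (binom (suc n) j *_) (nth-eulerList n j (ℕP.≤-pred j<1+n)))) ⟩
    (- ℚ.½) * Σ< (suc n) (λ j → binom (suc n) j * eulerNum j)
  ∎
  where
  last : ℚ
  last = (- ℚ.½) * Σ[ 0 ⋯ n ] (λ j → binom (suc n) j * nth (eulerList n) j)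

eulerNum-relation : ∀ n → binomialConv eulerNum (powers 1ℚ) n + eulerNum n ≡ two * δ n
eulerNum-relation zero    = refl
eulerNum-relation (suc n) = begin
    Σ< (suc n) (λ j → binom (suc n) j * eulerNum j * 1ℚ ^ℚ (suc n ∸ j))
      + binom (suc n) (suc n) * eulerNum (suc n) * 1ℚ ^ℚ (suc n ∸ suc n) + eulerNum (suc n)
  ≡⟨ cong₃ (λ u v w → u + v * eulerNum (suc n) * w + eulerNum (suc n))
       (Σ-cong′ (suc n) (λ j → trans (cong (binom (suc n) j * eulerNum j *_) (1^ℚ (suc n ∸ j))) (ℚP.*-identityʳ _)))
       (cong ℕtoℚ (nCn≡1 (suc n))) (1^ℚ (suc n ∸ suc n)) ⟩
    s + 1ℚ * eulerNum (suc n) * 1ℚ + eulerNum (suc n)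
  ≡⟨ cong (λ e → s + 1ℚ * e * 1ℚ + e) (eulerNum-suc n) ⟩
    s + 1ℚ * ((- ℚ.½) * s) * 1ℚ + (- ℚ.½) * s
  ≡⟨ halves-cancel s ⟩
    two * 0ℚ
  ∎
  where
  s = Σ< (suc n) (λ j → binom (suc n) j * eulerNum j)
  halves-cancel : ∀ s → s + 1ℚ * ((- ℚ.½) * s) * 1ℚ + (- ℚ.½) * s ≡ two * 0ℚ
  halves-cancel = solve-∀ ℚ-ring

Ê : Seq
Ê = egf eulerNum

eᵗ : Seq
eᵗ = egf (powers 1ℚ)

1+eᵗ : Seq
1+eᵗ = δ ⊕ eᵗ

-- The defining identity (1 + eᵗ) · 2 / (eᵗ + 1) = 2.
Ê-⊛-1+eᵗ : Ê ⊛ 1+eᵗ ≗ two · δ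
Ê-⊛-1+eᵗ n = begin
  (Ê ⊛ 1+eᵗ) n                                             ≡⟨ ⊛-distribˡ-⊕ Ê δ eᵗ n ⟩
  (Ê ⊛ δ) n + (Ê ⊛ eᵗ) n                                   ≡⟨ cong₂ _+_ (⊛-identityʳ Ê n)
                                                                (sym (egf-binomialConv eulerNum (powers 1ℚ) n)) ⟩
  Ê n + egf (binomialConv eulerNum (powers 1ℚ)) n          ≡⟨ ℚP.+-comm (Ê n) _ ⟩
  egf (binomialConv eulerNum (powers 1ℚ)) n + Ê n          ≡⟨ egf-⊕ (binomialConv eulerNum (powers 1ℚ)) eulerNum n ⟨
  egf (binomialConv eulerNum (powers 1ℚ) ⊕ eulerNum) n     ≡⟨ cong (_* invFact n) (eulerNum-relation n) ⟩
  egf (two · δ) n                                          ≡⟨ egf-· two δ n ⟩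
  two * egf δ n                                            ≡⟨ cong (two *_) (egf-δ n) ⟩
  two * δ n                                                ∎

eulerPolys : ℚ → Seq
eulerPolys x n = eulerPoly n x

egf-eulerPolys : ∀ x → egf (eulerPolys x) ≗ Ê ⊛ egf (powers x)
egf-eulerPolys x = egf-binomialConv eulerNum (powers x)

eulerPoly-0 : ∀ n → eulerPoly n 0ℚ ≡ eulerNum n
eulerPoly-0 n = egf-injective (eulerPolys 0ℚ) eulerNum n
  (trans (egf-eulerPolys 0ℚ n) (⊛-egf-powers-0 Ê n))

eulerPoly-shift : ∀ x n → eulerPoly n (x + 1ℚ) + eulerPoly n x ≡ two * x ^ℚ n
eulerPoly-shift x n = egf-injective (eulerPolys (x + 1ℚ) ⊕ eulerPolys x) (two · powers x) n (begin
    egf (eulerPolys (x + 1ℚ) ⊕ eulerPolys x) n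
  ≡⟨ trans (egf-⊕ (eulerPolys (x + 1ℚ)) (eulerPolys x) n)
           (ℚP.+-comm (egf (eulerPolys (x + 1ℚ)) n) (egf (eulerPolys x) n)) ⟩
    egf (eulerPolys x) n + egf (eulerPolys (x + 1ℚ)) n
  ≡⟨ cong₂ _+_ (egf-eulerPolys x n)
               (trans (egf-eulerPolys (x + 1ℚ) n) (⊛-congʳ Ê (egf-powers-+ x 1ℚ) n)) ⟩
    (Ê ⊛ X) n + (Ê ⊛ (X ⊛ eᵗ)) n
  ≡⟨ cong (_+ (Ê ⊛ (X ⊛ eᵗ)) n) (⊛-congʳ Ê (⊛-identityʳ X) n) ⟨
    (Ê ⊛ (X ⊛ δ)) n + (Ê ⊛ (X ⊛ eᵗ)) n
  ≡⟨ ⊛-distribˡ-⊕ Ê (X ⊛ δ) (X ⊛ eᵗ) n ⟨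
    (Ê ⊛ (X ⊛ δ ⊕ X ⊛ eᵗ)) n
  ≡⟨ ⊛-congʳ Ê (⊛-distribˡ-⊕ X δ eᵗ) n ⟨
    (Ê ⊛ (X ⊛ 1+eᵗ)) n
  ≡⟨ ⊛-congʳ Ê (⊛-comm X 1+eᵗ) n ⟩
    (Ê ⊛ (1+eᵗ ⊛ X)) n
  ≡⟨ ⊛-assoc Ê 1+eᵗ X n ⟨
    (Ê ⊛ 1+eᵗ ⊛ X) n
  ≡⟨ ⊛-congˡ X Ê-⊛-1+eᵗ n ⟩
    (two · δ ⊛ X) n
  ≡⟨ trans (·-⊛ two δ X n) (cong (two *_) (⊛-identityˡ X n)) ⟩
    two * X n
  ≡⟨ egf-· two (powers x) n ⟨
    egf (two · powers x) n
  ∎)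
  where
  X = egf (powers x)

alternate-eᵗ-⊛-eᵗ : alternate eᵗ ⊛ eᵗ ≗ δ
alternate-eᵗ-⊛-eᵗ n = begin
  (alternate eᵗ ⊛ eᵗ) n                        ≡⟨ ⊛-congˡ eᵗ alternate-eᵗ n ⟩
  (egf (powers (- 1ℚ)) ⊛ egf (powers 1ℚ)) n    ≡⟨ egf-powers-+ (- 1ℚ) 1ℚ n ⟨
  egf (powers (- 1ℚ + 1ℚ)) n                   ≡⟨ cong (λ z → egf (powers z) n) (ℚP.+-inverseˡ 1ℚ) ⟩
  egf (powers 0ℚ) n                            ≡⟨ egf-powers-0 n ⟩
  δ n                                          ∎
  where
  alternate-eᵗ : alternate eᵗ ≗ egf (powers (- 1ℚ))
  alternate-eᵗ i = begin
    sgn i * (1ℚ ^ℚ i * invFact i)   ≡⟨ cong (λ z → sgn i * (z * invFact i)) (1^ℚ i) ⟩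
    sgn i * (1ℚ * invFact i)        ≡⟨ cong (sgn i *_) (ℚP.*-identityˡ (invFact i)) ⟩
    sgn i * invFact i               ≡⟨ cong (_* invFact i) (sgn≡-1^ℚ i) ⟩
    (- 1ℚ) ^ℚ i * invFact i         ∎

1+eᵗ-factor : 1+eᵗ ≗ (δ ⊕ alternate eᵗ) ⊛ eᵗ
1+eᵗ-factor n = sym (begin
  ((δ ⊕ alternate eᵗ) ⊛ eᵗ) n           ≡⟨ ⊛-distribʳ-⊕ δ (alternate eᵗ) eᵗ n ⟩
  (δ ⊛ eᵗ) n + (alternate eᵗ ⊛ eᵗ) n    ≡⟨ cong₂ _+_ (⊛-identityˡ eᵗ n) (alternate-eᵗ-⊛-eᵗ n) ⟩
  eᵗ n + δ n                            ≡⟨ ℚP.+-comm (eᵗ n) (δ n) ⟩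
  1+eᵗ n                                ∎)

alternate-1+eᵗ : δ ⊕ alternate eᵗ ≗ alternate 1+eᵗ
alternate-1+eᵗ n = sym (trans (ℚP.*-distribˡ-+ (sgn n) (δ n) (eᵗ n)) (cong (_+ alternate eᵗ n) (alternate-δ n)))

alternate-two·δ : alternate (two · δ) ≗ two · δ
alternate-two·δ n = trans (swap (sgn n) two (δ n)) (cong (two *_) (alternate-δ n))
  where
  swap : ∀ a b c → a * (b * c) ≡ b * (a * c)
  swap = solve-∀ ℚ-ring

-- Both Ê(-t) and eᵗ Ê(t) solve f · (1 + eᵗ) = 2 eᵗ, and 1 + eᵗ is cancellable.
alternate-Ê≗Ê⊛eᵗ : alternate Ê ≗ Ê ⊛ eᵗ
alternate-Ê≗Ê⊛eᵗ =
  ⊛-cancelʳ 1+eᵗ {ℚ.½} refl (λ n → trans (alternate-Ê-⊛-1+eᵗ n) (sym (Ê-⊛-eᵗ-⊛-1+eᵗ n)))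
  where
  two·δ-⊛-eᵗ : two · δ ⊛ eᵗ ≗ two · eᵗ
  two·δ-⊛-eᵗ n = trans (·-⊛ two δ eᵗ n) (cong (two *_) (⊛-identityˡ eᵗ n))
  alternate-Ê-⊛-1+eᵗ : alternate Ê ⊛ 1+eᵗ ≗ two · eᵗ
  alternate-Ê-⊛-1+eᵗ n = begin
    (alternate Ê ⊛ 1+eᵗ) n                           ≡⟨ ⊛-congʳ (alternate Ê) 1+eᵗ-factor n ⟩
    (alternate Ê ⊛ ((δ ⊕ alternate eᵗ) ⊛ eᵗ)) n      ≡⟨ ⊛-assoc (alternate Ê) (δ ⊕ alternate eᵗ) eᵗ n ⟨
    (alternate Ê ⊛ (δ ⊕ alternate eᵗ) ⊛ eᵗ) n        ≡⟨ ⊛-congˡ eᵗ alternate-Ê-⊛-1+e⁻ᵗ n ⟩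
    (two · δ ⊛ eᵗ) n                                 ≡⟨ two·δ-⊛-eᵗ n ⟩
    two * eᵗ n                                       ∎
    where
    alternate-Ê-⊛-1+e⁻ᵗ : alternate Ê ⊛ (δ ⊕ alternate eᵗ) ≗ two · δ
    alternate-Ê-⊛-1+e⁻ᵗ i = begin
      (alternate Ê ⊛ (δ ⊕ alternate eᵗ)) i  ≡⟨ ⊛-congʳ (alternate Ê) alternate-1+eᵗ i ⟩
      (alternate Ê ⊛ alternate 1+eᵗ) i      ≡⟨ alternate-⊛ Ê 1+eᵗ i ⟨
      sgn i * (Ê ⊛ 1+eᵗ) i                  ≡⟨ cong (sgn i *_) (Ê-⊛-1+eᵗ i) ⟩
      sgn i * (two * δ i)                   ≡⟨ alternate-two·δ i ⟩
      two * δ i                             ∎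
  Ê-⊛-eᵗ-⊛-1+eᵗ : Ê ⊛ eᵗ ⊛ 1+eᵗ ≗ two · eᵗ
  Ê-⊛-eᵗ-⊛-1+eᵗ n = begin
    (Ê ⊛ eᵗ ⊛ 1+eᵗ) n     ≡⟨ ⊛-assoc Ê eᵗ 1+eᵗ n ⟩
    (Ê ⊛ (eᵗ ⊛ 1+eᵗ)) n   ≡⟨ ⊛-congʳ Ê (⊛-comm eᵗ 1+eᵗ) n ⟩
    (Ê ⊛ (1+eᵗ ⊛ eᵗ)) n   ≡⟨ ⊛-assoc Ê 1+eᵗ eᵗ n ⟨
    (Ê ⊛ 1+eᵗ ⊛ eᵗ) n     ≡⟨ ⊛-congˡ eᵗ Ê-⊛-1+eᵗ n ⟩
    (two · δ ⊛ eᵗ) n      ≡⟨ two·δ-⊛-eᵗ n ⟩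
    two * eᵗ n            ∎

eulerNum-double : ∀ j → eulerNum (double (suc j)) ≡ 0ℚ
eulerNum-double j = egf-injective eulerNum (λ _ → 0ℚ) n
  (trans (*-two-injective Ê[n]*two≡0*two) (sym (ℚP.*-zeroˡ (invFact n))))
  where
  n = double (suc j)
  Ê[n]*two≡0*two : Ê n * two ≡ 0ℚ * two
  Ê[n]*two≡0*two = begin
    Ê n * two                        ≡⟨ ℚP.*-distribˡ-+ (Ê n) 1ℚ 1ℚ ⟩
    Ê n * 1ℚ + Ê n * 1ℚ              ≡⟨ cong (λ z → z + z) (ℚP.*-identityʳ (Ê n)) ⟩
    Ê n + Ê n                        ≡⟨ cong (_+_ (Ê n)) (ℚP.*-identityˡ (Ê n)) ⟨
    Ê n + 1ℚ * Ê n                   ≡⟨ cong (λ s → Ê n + s * Ê n) (sgn-double (suc j)) ⟨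
    Ê n + alternate Ê n              ≡⟨ cong₂ _+_ (sym (⊛-identityʳ Ê n)) (alternate-Ê≗Ê⊛eᵗ n) ⟩
    (Ê ⊛ δ) n + (Ê ⊛ eᵗ) n           ≡⟨ ⊛-distribˡ-⊕ Ê δ eᵗ n ⟨
    (Ê ⊛ 1+eᵗ) n                     ≡⟨ Ê-⊛-1+eᵗ n ⟩
    two * 0ℚ                         ≡⟨ ℚP.*-comm two 0ℚ ⟩
    0ℚ * two                         ∎

natZPow-1 : ∀ z → natZPow 1 z ≡ 1ℚ
natZPow-1 (+ j)    = cong ℕtoℚ (ℕP.^-zeroˡ j)
natZPow-1 -[1+ j ] = ℚP./-cong {+ 1} {1 ℕ.^ suc j} {+ 1} {1} {{ℕP.m^n≢0 1 (suc j)}} refl (ℕP.^-zeroˡ (suc j))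

eiLogCoeff-1 : ∀ k → eiLogCoeff k 1 ≡ 1ℚ
eiLogCoeff-1 k = trans (ℚP.+-identityˡ _) (cong (_* 1ℚ) (natZPow-1 (+ 1 ℤ.- k)))

polyEulerNum-0 : ∀ k → polyEulerNum k 0 ≡ 1ℚ
polyEulerNum-0 k = cong (λ a₁ → (0ℚ + binom 1 0 * 0ℚ * eulerPoly 1 0ℚ + binom 1 1 * a₁ * eulerPoly 0 0ℚ) * 1/ℕ 1)
  (eiLogCoeff-1 k)

polyEulerPolys : ℤ → ℚ → Seq
polyEulerPolys k x n = polyEulerPoly k n x

-- The egf of E_n^{(k)}(x) is Ei_k(log(1+t))/t · 2/(eᵗ+1) · e^{xt};
-- dividing by t just shifts the coefficients, since a_0^{(k)} = 0.
egf-polyEulerPolys : ∀ k x → egf (polyEulerPolys k x) ≗ (λ i → egf (eiLogCoeff k) (suc i)) ⊛ (Ê ⊛ egf (powers x))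
egf-polyEulerPolys k x n = begin
    polyGenocchi k (suc n) x * 1/ℕ (suc n) * invFact n
  ≡⟨ trans (ℚP.*-assoc (polyGenocchi k (suc n) x) _ _) (cong (polyGenocchi k (suc n) x *_) (1/ℕ-suc-*-invFact n)) ⟩
    egf (binomialConv (eiLogCoeff k) (eulerPolys x)) (suc n)
  ≡⟨ egf-binomialConv (eiLogCoeff k) (eulerPolys x) (suc n) ⟩
    (egf (eiLogCoeff k) ⊛ egf (eulerPolys x)) (suc n)
  ≡⟨ ⊛-suc (egf (eiLogCoeff k)) (egf (eulerPolys x)) refl n ⟩
    ((λ i → egf (eiLogCoeff k) (suc i)) ⊛ egf (eulerPolys x)) n
  ≡⟨ ⊛-congʳ (λ i → egf (eiLogCoeff k) (suc i)) (egf-eulerPolys x) n ⟩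
    ((λ i → egf (eiLogCoeff k) (suc i)) ⊛ (Ê ⊛ egf (powers x))) n
  ∎

polyEulerPoly-appell : ∀ k x n → polyEulerPoly k n x ≡ binomialConv (polyEulerNum k) (powers x) n
polyEulerPoly-appell k x n = egf-injective (polyEulerPolys k x) (binomialConv (polyEulerNum k) (powers x)) n (begin
    egf (polyEulerPolys k x) n
  ≡⟨ egf-polyEulerPolys k x n ⟩
    (A ⊛ (Ê ⊛ X)) n
  ≡⟨ ⊛-assoc A Ê X n ⟨
    (A ⊛ Ê ⊛ X) n
  ≡⟨ ⊛-congˡ X {A ⊛ Ê} {egf (polyEulerNum k)} egf-polyEulerNum n ⟩
    (egf (polyEulerNum k) ⊛ X) n
  ≡⟨ egf-binomialConv (polyEulerNum k) (powers x) n ⟨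
    egf (binomialConv (polyEulerNum k) (powers x)) n
  ∎)
  where
  A = λ i → egf (eiLogCoeff k) (suc i)
  X = egf (powers x)
  egf-polyEulerNum : A ⊛ Ê ≗ egf (polyEulerNum k)
  egf-polyEulerNum i = sym (begin
    egf (polyEulerNum k) i     ≡⟨ egf-polyEulerPolys k 0ℚ i ⟩
    (A ⊛ (Ê ⊛ egf (powers 0ℚ))) i ≡⟨ ⊛-congʳ A (⊛-egf-powers-0 Ê) i ⟩
    (A ⊛ Ê) i                  ∎)

alternatingPowerSum : ∀ q t →
  two * Σ< (double q) (λ i → sgn (suc i) * ℕtoℚ (suc i) ^ℚ suc t) ≡
  eulerPoly (suc t) (ℕtoℚ (suc (double q))) + eulerNum (suc t)
alternatingPowerSum zero    t = sym (begin
  eulerPoly (suc t) (ℕtoℚ 1) + eulerNum (suc t)    ≡⟨ cong (_+_ (eulerPoly (suc t) (ℕtoℚ 1))) (eulerPoly-0 (suc t)) ⟨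
  eulerPoly (suc t) (0ℚ + 1ℚ) + eulerPoly (suc t) 0ℚ ≡⟨ eulerPoly-shift 0ℚ (suc t) ⟩
  two * 0ℚ ^ℚ suc t                                ≡⟨ cong (two *_) (0^ℚsuc t) ⟩
  two * 0ℚ                                         ∎)
alternatingPowerSum (suc q) t = begin
    two * (Σ< d f + (- sgn d) * X₁ + (- - sgn d) * X₂)
  ≡⟨ cong (λ s → two * (Σ< d f + (- s) * X₁ + (- - s) * X₂)) (sgn-double q) ⟩
    two * (Σ< d f + (- 1ℚ) * X₁ + (- - 1ℚ) * X₂)
  ≡⟨ distribute (Σ< d f) X₁ X₂ ⟩
    two * Σ< d f - two * X₁ + two * X₂
  ≡⟨ cong₃ (λ u v w → u - v + w) (alternatingPowerSum q t) (sym (shift (suc d))) (sym (shift (suc (suc d)))) ⟩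
    (P (suc d) + eulerNum n) - (P (suc (suc d)) + P (suc d)) + (P (suc (suc (suc d))) + P (suc (suc d)))
  ≡⟨ telescope (P (suc d)) (P (suc (suc d))) (P (suc (suc (suc d)))) (eulerNum n) ⟩
    P (suc (suc (suc d))) + eulerNum n
  ∎
  where
  n = suc t
  d = double q
  f = λ i → sgn (suc i) * ℕtoℚ (suc i) ^ℚ n
  X₁ = ℕtoℚ (suc d) ^ℚ n
  X₂ = ℕtoℚ (suc (suc d)) ^ℚ n
  P : ℕ → ℚ
  P a = eulerPoly n (ℕtoℚ a)
  shift : ∀ a → P (suc a) + P a ≡ two * ℕtoℚ a ^ℚ n
  shift a = trans (cong (λ z → eulerPoly n z + P a) (ℕtoℚ-suc a)) (eulerPoly-shift (ℕtoℚ a) n)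
  distribute : ∀ s x y → two * (s + (- 1ℚ) * x + (- - 1ℚ) * y) ≡ two * s - two * x + two * y
  distribute = solve-∀ ℚ-ring
  telescope : ∀ p₁ p₂ p₃ e → (p₁ + e) - (p₂ + p₁) + (p₃ + p₂) ≡ p₃ + e
  telescope = solve-∀ ℚ-ring

floor-fracℚ : ∀ μ m′ → μ < suc m′ → floor (fracℚ μ (suc m′)) ≡ + 0
floor-fracℚ μ m′ μ<m = floor-of (fracℚ μ (suc m′)) (toℚᵘ-/ (+ μ) m′)
  where
  floor-of : ∀ x → ℚ.toℚᵘ x ℚᵘ.≃ ℚᵘ.mkℚᵘ (+ μ) m′ → floor x ≡ + 0
  floor-of (mkℚ (+ a) d _) (ℚᵘ.*≡* eq) = trans (div-pos-is-/ℕ (+ a) (suc d)) (cong (λ n → + n) (m<n⇒m/n≡0 a<1+d))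
    where
    a*m≡μ*[1+d] : a ℕ.* suc m′ ≡ μ ℕ.* suc d
    a*m≡μ*[1+d] = ℤP.+-injective (trans (ℤP.pos-* a (suc m′)) (trans eq (sym (ℤP.pos-* μ (suc d)))))
    a<1+d : a < suc d
    a<1+d = ℕP.*-cancelʳ-< (suc m′) a (suc d) (subst (_< suc d ℕ.* suc m′) (sym a*m≡μ*[1+d])
              (subst (μ ℕ.* suc d <_) (ℕP.*-comm (suc m′) (suc d)) (ℕP.*-monoˡ-< (suc d) μ<m)))
  floor-of (mkℚ -[1+ a ] d _) (ℚᵘ.*≡* eq) with trans eq (sym (ℤP.pos-* μ (suc d)))
  ... | ()

fracℚ-*-ℕtoℚ : ∀ μ m′ → fracℚ μ (suc m′) * ℕtoℚ (suc m′) ≡ ℕtoℚ μ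
fracℚ-*-ℕtoℚ μ m′ =
  ≡-via-ℚᵘ (toℚᵘ-* (fracℚ μ (suc m′)) (ℕtoℚ (suc m′)) (toℚᵘ-/ (+ μ) m′) (toℚᵘ-/ (+ suc m′) 0))
  (toℚᵘ-/ (+ μ) 0) (ℚᵘ.*≡* (trans (ℤP.*-identityʳ _) (cong (λ z → + μ ℤ.* + z) (sym (ℕP.*-identityʳ (suc m′))))))

natZPow-pred-*-^ℚ : ∀ m′ ν s →
  natZPow (suc m′) (+ ν ℤ.- + 1) * ℕtoℚ (suc m′) ^ℚ suc s ≡ ℕtoℚ (suc m′) ^ℚ (ν ℕ.+ s)
natZPow-pred-*-^ℚ m′ ν s = begin
  natZPow (suc m′) (+ ν ℤ.- + 1) * (M * M ^ℚ s)  ≡⟨ ℚP.*-assoc (natZPow (suc m′) (+ ν ℤ.- + 1)) M (M ^ℚ s) ⟨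
  natZPow (suc m′) (+ ν ℤ.- + 1) * M * M ^ℚ s    ≡⟨ cong (_* M ^ℚ s) (natZPow-pred-* ν) ⟩
  M ^ℚ ν * M ^ℚ s                                ≡⟨ ^ℚ-+ M ν s ⟨
  M ^ℚ (ν ℕ.+ s)                                 ∎
  where
  M = ℕtoℚ (suc m′)
  natZPow-pred-* : ∀ ν → natZPow (suc m′) (+ ν ℤ.- + 1) * M ≡ M ^ℚ ν
  natZPow-pred-* zero = begin
    (+ 1) ℚ./ (suc m′ ℕ.^ 1) * M  ≡⟨ cong (_* M) (ℚP./-cong {+ 1} {suc m′ ℕ.^ 1} {+ 1} {suc m′} {{ℕP.m^n≢0 (suc m′) 1}}
                                        refl (ℕP.*-identityʳ (suc m′))) ⟩
    1/ℕ (suc m′) * M              ≡⟨ ℚP.*-comm (1/ℕ (suc m′)) M ⟩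
    M * 1/ℕ (suc m′)              ≡⟨ ℕtoℚ-*-1/ℕ (suc m′) ⟩
    1ℚ                            ∎
  natZPow-pred-* (suc j) = trans (cong (_* M) (ℕtoℚ-^ (suc m′) j)) (ℚP.*-comm (M ^ℚ j) M)

T-1 : ∀ k p m′ → T k p 1 (suc m′) ≡
  two * Σ< m′ (λ i → sgn (suc i) * fracℚ (suc i) (suc m′) * polyEulerPoly k p (fracℚ (suc i) (suc m′)))
T-1 k p m′ = cong (two *_) (trans (sumFrom-shift 1 m′ _) (Σ-cong m′ (λ i i<m′ →
  cong (sgn (suc i) * fracℚ (suc i) (suc m′) *_) (polyEulerFun-fracℚ (suc i) (s≤s i<m′)))))
  where
  polyEulerFun-fracℚ : ∀ μ → μ < suc m′ →
    polyEulerFun k p (fracℚ (1 ℕ.* μ) (suc m′)) ≡ polyEulerPoly k p (fracℚ μ (suc m′))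
  polyEulerFun-fracℚ μ μ<m = begin
      polyEulerPoly k p (fracℚ (1 ℕ.* μ) (suc m′) - ℤtoℚ (floor (fracℚ (1 ℕ.* μ) (suc m′))))
    ≡⟨ cong (λ z → polyEulerPoly k p (fracℚ z (suc m′) - ℤtoℚ (floor (fracℚ z (suc m′))))) (ℕP.*-identityˡ μ) ⟩
      polyEulerPoly k p (fracℚ μ (suc m′) - ℤtoℚ (floor (fracℚ μ (suc m′))))
    ≡⟨ cong (λ z → polyEulerPoly k p (fracℚ μ (suc m′) - ℤtoℚ z)) (floor-fracℚ μ m′ μ<m) ⟩
      polyEulerPoly k p (fracℚ μ (suc m′) + 0ℚ)
    ≡⟨ cong (polyEulerPoly k p) (ℚP.+-identityʳ (fracℚ μ (suc m′))) ⟩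
      polyEulerPoly k p (fracℚ μ (suc m′))
    ∎

scaled-polyEulerPoly : ∀ k p m′ μ →
  ℕtoℚ (suc m′) ^ℚ p * (fracℚ μ (suc m′) * polyEulerPoly k p (fracℚ μ (suc m′))) ≡
  Σ< (suc p) (λ ν → binom p ν * polyEulerNum k ν * natZPow (suc m′) (+ ν ℤ.- + 1) * ℕtoℚ μ ^ℚ (suc p ∸ ν))
scaled-polyEulerPoly k p m′ μ = begin
    M ^ℚ p * (f * polyEulerPoly k p f)
  ≡⟨ cong (λ z → M ^ℚ p * (f * z)) (polyEulerPoly-appell k f p) ⟩
    M ^ℚ p * (f * Σ< (suc p) (λ ν → binom p ν * polyEulerNum k ν * f ^ℚ (p ∸ ν)))
  ≡⟨ cong (M ^ℚ p *_) (*-distribˡ-Σ (suc p) f _) ⟩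
    M ^ℚ p * Σ< (suc p) (λ ν → f * (binom p ν * polyEulerNum k ν * f ^ℚ (p ∸ ν)))
  ≡⟨ *-distribˡ-Σ (suc p) (M ^ℚ p) _ ⟩
    Σ< (suc p) (λ ν → M ^ℚ p * (f * (binom p ν * polyEulerNum k ν * f ^ℚ (p ∸ ν))))
  ≡⟨ Σ-cong (suc p) (λ ν ν<1+p → term ν (ℕP.≤-pred ν<1+p)) ⟩
    Σ< (suc p) (λ ν → binom p ν * polyEulerNum k ν * natZPow (suc m′) (+ ν ℤ.- + 1) * ℕtoℚ μ ^ℚ (suc p ∸ ν))
  ∎
  where
  M = ℕtoℚ (suc m′)
  f = fracℚ μ (suc m′)
  regroup : ∀ m f b ft → m * (f * (b * ft)) ≡ b * (f * ft * m)
  regroup = solve-∀ ℚ-ring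
  term : ∀ ν → ν ℕ.≤ p → M ^ℚ p * (f * (binom p ν * polyEulerNum k ν * f ^ℚ (p ∸ ν))) ≡
    binom p ν * polyEulerNum k ν * natZPow (suc m′) (+ ν ℤ.- + 1) * ℕtoℚ μ ^ℚ (suc p ∸ ν)
  term ν ν≤p = begin
      M ^ℚ p * (f * (b * f ^ℚ t))
    ≡⟨ regroup (M ^ℚ p) f b (f ^ℚ t) ⟩
      b * (f ^ℚ suc t * M ^ℚ p)
    ≡⟨ cong (λ z → b * (f ^ℚ suc t * M ^ℚ z)) (sym (ℕP.m+[n∸m]≡n ν≤p)) ⟩
      b * (f ^ℚ suc t * M ^ℚ (ν ℕ.+ t))
    ≡⟨ cong (λ z → b * (f ^ℚ suc t * z)) (natZPow-pred-*-^ℚ m′ ν t) ⟨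
      b * (f ^ℚ suc t * (w * M ^ℚ suc t))
    ≡⟨ cong (b *_) (swap (f ^ℚ suc t) w (M ^ℚ suc t)) ⟩
      b * (w * (f ^ℚ suc t * M ^ℚ suc t))
    ≡⟨ cong (λ z → b * (w * z)) (trans (sym (*-^ℚ f M (suc t))) (cong (_^ℚ suc t) (fracℚ-*-ℕtoℚ μ m′))) ⟩
      b * (w * ℕtoℚ μ ^ℚ suc t)
    ≡⟨ ℚP.*-assoc b w _ ⟨
      b * w * ℕtoℚ μ ^ℚ suc t
    ≡⟨ cong (λ z → b * w * ℕtoℚ μ ^ℚ z) (ℕP.+-∸-assoc 1 ν≤p) ⟨
      b * w * ℕtoℚ μ ^ℚ (suc p ∸ ν)
    ∎
    where
    t = p ∸ ν
    b = binom p ν * polyEulerNum k ν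
    w = natZPow (suc m′) (+ ν ℤ.- + 1)
    swap : ∀ x y z → x * (y * z) ≡ y * (x * z)
    swap = solve-∀ ℚ-ring

coeff : ℤ → ℕ → ℕ → ℕ → ℚ
coeff k p m ν = binom p ν * polyEulerNum k ν * natZPow m (+ ν ℤ.- + 1)

expansionTerm : ℤ → ℕ → ℕ → ℕ → ℕ → ℚ
expansionTerm k p m ν i = binom p ν * binom (suc p ∸ ν) i * polyEulerNum k ν * eulerNum i * (ℕtoℚ m ^ℚ (p ∸ i))

scaledT : ∀ k p q → ℕtoℚ (suc (double q)) ^ℚ p * T k p 1 (suc (double q)) ≡
  Σ< (suc p) (λ ν → coeff k p (suc (double q)) ν * (eulerPoly (suc p ∸ ν) (ℕtoℚ (suc (double q))) + eulerNum (suc p ∸ ν)))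
scaledT k p q = begin
    M ^ℚ p * T k p 1 (suc m′)
  ≡⟨ cong (M ^ℚ p *_) (T-1 k p m′) ⟩
    M ^ℚ p * (two * Σ< m′ (λ i → sgn (suc i) * fr (suc i) * polyEulerPoly k p (fr (suc i))))
  ≡⟨ swap (M ^ℚ p) two _ ⟩
    two * (M ^ℚ p * Σ< m′ (λ i → sgn (suc i) * fr (suc i) * polyEulerPoly k p (fr (suc i))))
  ≡⟨ cong (two *_) (trans (*-distribˡ-Σ m′ (M ^ℚ p) _) (Σ-cong′ m′ expand)) ⟩
    two * Σ< m′ (λ i → Σ< (suc p) (λ ν → c ν * X ν i))
  ≡⟨ cong (two *_) (Σ-swap m′ (suc p) (λ i ν → c ν * X ν i)) ⟩
    two * Σ< (suc p) (λ ν → Σ< m′ (λ i → c ν * X ν i))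
  ≡⟨ *-distribˡ-Σ (suc p) two _ ⟩
    Σ< (suc p) (λ ν → two * Σ< m′ (λ i → c ν * X ν i))
  ≡⟨ Σ-cong (suc p) (λ ν ν<1+p → column ν (ℕP.≤-pred ν<1+p)) ⟩
    Σ< (suc p) (λ ν → c ν * (eulerPoly (suc p ∸ ν) M + eulerNum (suc p ∸ ν)))
  ∎
  where
  m′ = double q
  M = ℕtoℚ (suc m′)
  fr = λ μ → fracℚ μ (suc m′)
  c = coeff k p (suc m′)
  X : ℕ → ℕ → ℚ
  X ν i = sgn (suc i) * ℕtoℚ (suc i) ^ℚ (suc p ∸ ν)
  swap : ∀ x y z → x * (y * z) ≡ y * (x * z)
  swap = solve-∀ ℚ-ring
  expand : ∀ i → M ^ℚ p * (sgn (suc i) * fr (suc i) * polyEulerPoly k p (fr (suc i))) ≡ Σ< (suc p) (λ ν → c ν * X ν i)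
  expand i = begin
      M ^ℚ p * (s * fr (suc i) * polyEulerPoly k p (fr (suc i)))
    ≡⟨ trans (cong (M ^ℚ p *_) (ℚP.*-assoc s _ _)) (swap (M ^ℚ p) s _) ⟩
      s * (M ^ℚ p * (fr (suc i) * polyEulerPoly k p (fr (suc i))))
    ≡⟨ cong (s *_) (scaled-polyEulerPoly k p m′ (suc i)) ⟩
      s * Σ< (suc p) (λ ν → c ν * ℕtoℚ (suc i) ^ℚ (suc p ∸ ν))
    ≡⟨ *-distribˡ-Σ (suc p) s _ ⟩
      Σ< (suc p) (λ ν → s * (c ν * ℕtoℚ (suc i) ^ℚ (suc p ∸ ν)))
    ≡⟨ Σ-cong′ (suc p) (λ ν → swap s (c ν) _) ⟩
      Σ< (suc p) (λ ν → c ν * X ν i)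
    ∎
    where
    s = sgn (suc i)
  column : ∀ ν → ν ℕ.≤ p →
    two * Σ< m′ (λ i → c ν * X ν i) ≡ c ν * (eulerPoly (suc p ∸ ν) M + eulerNum (suc p ∸ ν))
  column ν ν≤p = begin
      two * Σ< m′ (λ i → c ν * X ν i)
    ≡⟨ cong (two *_) (*-distribˡ-Σ m′ (c ν) (X ν)) ⟨
      two * (c ν * Σ< m′ (X ν))
    ≡⟨ swap two (c ν) _ ⟩
      c ν * (two * Σ< m′ (X ν))
    ≡⟨ cong (λ n → c ν * (two * Σ< m′ (λ i → sgn (suc i) * ℕtoℚ (suc i) ^ℚ n))) (ℕP.+-∸-assoc 1 ν≤p) ⟩
      c ν * (two * Σ< m′ (λ i → sgn (suc i) * ℕtoℚ (suc i) ^ℚ suc (p ∸ ν)))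
    ≡⟨ cong (c ν *_) (alternatingPowerSum q (p ∸ ν)) ⟩
      c ν * (eulerPoly (suc (p ∸ ν)) M + eulerNum (suc (p ∸ ν)))
    ≡⟨ cong (λ n → c ν * (eulerPoly n M + eulerNum n)) (ℕP.+-∸-assoc 1 ν≤p) ⟨
      c ν * (eulerPoly (suc p ∸ ν) M + eulerNum (suc p ∸ ν))
    ∎

eulerPoly-split : ∀ n x → eulerPoly n x ≡ Σ< n (λ i → binom n i * eulerNum i * x ^ℚ (n ∸ i)) + eulerNum n
eulerPoly-split n x = cong (_+_ (Σ< n (λ i → binom n i * eulerNum i * x ^ℚ (n ∸ i))))
  (trans (cong₂ (λ b e → b * eulerNum n * x ^ℚ e) (cong ℕtoℚ (nCn≡1 n)) (ℕP.n∸n≡0 n)) (unit (eulerNum n)))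
  where
  unit : ∀ e → 1ℚ * e * 1ℚ ≡ e
  unit = solve-∀ ℚ-ring

S-expansion : ∀ k p {m q} → m ≡ suc (double q) →
  S k p m ≡ Σ< (suc p) (λ ν → Σ< (suc p ∸ ν) (expansionTerm k p m ν))
S-expansion k p {q = q} refl = begin
    M ^ℚ p * T k p 1 m - two * Σ< (suc p) subtracted
  ≡⟨ cong (λ u → u - two * Σ< (suc p) subtracted) (scaledT k p q) ⟩
    Σ< (suc p) main + - (two * Σ< (suc p) subtracted)
  ≡⟨ cong (_+_ (Σ< (suc p) main)) (trans (cong -_ (*-distribˡ-Σ (suc p) two subtracted)) (neg-distrib-Σ (suc p) _)) ⟩
    Σ< (suc p) main + Σ< (suc p) (λ ν → - (two * subtracted ν))
  ≡⟨ Σ-distrib-+ (suc p) main _ ⟨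
    Σ< (suc p) (λ ν → main ν + - (two * subtracted ν))
  ≡⟨ Σ-cong (suc p) (λ ν ν<1+p → column ν (ℕP.≤-pred ν<1+p)) ⟩
    Σ< (suc p) (λ ν → Σ< (suc p ∸ ν) (expansionTerm k p m ν))
  ∎
  where
  m = suc (double q)
  M = ℕtoℚ m
  c = coeff k p m
  main subtracted : ℕ → ℚ
  main ν = c ν * (eulerPoly (suc p ∸ ν) M + eulerNum (suc p ∸ ν))
  subtracted ν = binom p ν * polyEulerNum k ν * eulerNum (suc p ∸ ν) * natZPow m (+ ν ℤ.- + 1)
  column : ∀ ν → ν ℕ.≤ p → main ν + - (two * subtracted ν) ≡ Σ< (suc p ∸ ν) (expansionTerm k p m ν)
  column ν ν≤p = begin
      c ν * (eulerPoly n M + eulerNum n) + - (two * (b * eulerNum n * w))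
    ≡⟨ cong (λ z → c ν * (z + eulerNum n) + - (two * (b * eulerNum n * w))) (eulerPoly-split n M) ⟩
      c ν * ((Σ< n h + eulerNum n) + eulerNum n) + - (two * (b * eulerNum n * w))
    ≡⟨ cancel b w (Σ< n h) (eulerNum n) ⟩
      c ν * Σ< n h
    ≡⟨ *-distribˡ-Σ n (c ν) h ⟩
      Σ< n (λ i → c ν * h i)
    ≡⟨ Σ-cong n (λ i i<n → term i (ℕP.≤-pred (subst (i <_) n≡1+t i<n))) ⟩
      Σ< n (expansionTerm k p m ν)
    ∎
    where
    n = suc p ∸ ν
    t = p ∸ ν
    n≡1+t : n ≡ suc t
    n≡1+t = ℕP.+-∸-assoc 1 ν≤p
    b = binom p ν * polyEulerNum k ν
    w = natZPow m (+ ν ℤ.- + 1)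
    h : ℕ → ℚ
    h i = binom n i * eulerNum i * M ^ℚ (n ∸ i)
    cancel : ∀ b w s e → b * w * ((s + e) + e) + - (two * (b * e * w)) ≡ b * w * s
    cancel = solve-∀ ℚ-ring
    regroup : ∀ b c w bi e x → b * c * w * (bi * e * x) ≡ b * bi * c * e * (w * x)
    regroup = solve-∀ ℚ-ring
    exponent : ∀ i → i ℕ.≤ t → ν ℕ.+ (t ∸ i) ≡ p ∸ i
    exponent i i≤t = trans (sym (ℕP.+-∸-assoc ν i≤t)) (cong (_∸ i) (ℕP.m+[n∸m]≡n ν≤p))
    term : ∀ i → i ℕ.≤ t → c ν * h i ≡ expansionTerm k p m ν i
    term i i≤t = begin
        binom p ν * polyEulerNum k ν * w * (binom n i * eulerNum i * M ^ℚ (n ∸ i))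
      ≡⟨ regroup (binom p ν) (polyEulerNum k ν) w (binom n i) (eulerNum i) (M ^ℚ (n ∸ i)) ⟩
        binom p ν * binom n i * polyEulerNum k ν * eulerNum i * (w * M ^ℚ (n ∸ i))
      ≡⟨ cong (λ e → binom p ν * binom n i * polyEulerNum k ν * eulerNum i * (w * M ^ℚ e))
           (trans (cong (_∸ i) n≡1+t) (ℕP.+-∸-assoc 1 i≤t)) ⟩
        binom p ν * binom n i * polyEulerNum k ν * eulerNum i * (w * M ^ℚ suc (t ∸ i))
      ≡⟨ cong (binom p ν * binom n i * polyEulerNum k ν * eulerNum i *_)
           (trans (natZPow-pred-*-^ℚ (double q) ν (t ∸ i)) (cong (M ^ℚ_) (exponent i i≤t))) ⟩
        expansionTerm k p m ν i
      ∎

expansion-columns : ∀ k r m → eulerNum (suc r) ≡ 0ℚ → let p = suc (suc r) in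
  Σ< (suc p) (λ ν → Σ< (suc p ∸ ν) (expansionTerm k p m ν)) ≡
    Σ[ 1 ⋯ p ∸ 2 ] (λ i → Σ[ 0 ⋯ p ∸ i ] (λ ν → expansionTerm k p m ν i))
    + ℕtoℚ (suc p) * eulerNum p
    + ℕtoℚ m ^ℚ p * polyEulerPoly k p 1ℚ
expansion-columns k r m E[p-1]≡0 = begin
    Σ< (suc p) (λ ν → Σ< (suc p ∸ ν) (expansionTerm k p m ν))
  ≡⟨ Σ-triangle-swap (suc p) (expansionTerm k p m) ⟩
    Σ< (suc r) column + column (suc r) + column p
  ≡⟨ cong₃ (λ u v w → u + v + w) (Σ-suc r column) column-p-1 column-p ⟩
    column 0 + Σ< r (λ i → column (suc i)) + 0ℚ + ℕtoℚ (suc p) * eulerNum p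
  ≡⟨ cong₂ (λ u v → u + v + 0ℚ + ℕtoℚ (suc p) * eulerNum p) column-0 (sym middle) ⟩
    M ^ℚ p * polyEulerPoly k p 1ℚ + Middle + 0ℚ + ℕtoℚ (suc p) * eulerNum p
  ≡⟨ reorder (M ^ℚ p * polyEulerPoly k p 1ℚ) Middle (ℕtoℚ (suc p) * eulerNum p) ⟩
    Middle + ℕtoℚ (suc p) * eulerNum p + M ^ℚ p * polyEulerPoly k p 1ℚ
  ∎
  where
  p = suc (suc r)
  M = ℕtoℚ m
  column : ℕ → ℚ
  column i = Σ< (suc p ∸ i) (λ ν → expansionTerm k p m ν i)
  Middle = Σ[ 1 ⋯ p ∸ 2 ] (λ i → Σ[ 0 ⋯ p ∸ i ] (λ ν → expansionTerm k p m ν i))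
  reorder : ∀ a b d → a + b + 0ℚ + d ≡ b + d + a
  reorder = solve-∀ ℚ-ring
  middle : Middle ≡ Σ< r (λ i → column (suc i))
  middle = trans (sumFrom-shift 1 r _) (Σ-cong r (λ i i<r →
    cong (λ n → Σ< n (λ ν → expansionTerm k p m ν (suc i))) (sym (ℕP.+-∸-assoc 1 (ℕP.m<n⇒m<1+n (ℕP.m<n⇒m<1+n i<r))))))
  column-p-1 : column (suc r) ≡ 0ℚ
  column-p-1 = Σ-zero (suc p ∸ suc r) _ (λ ν _ → trans
    (cong (λ e → binom p ν * binom (suc p ∸ ν) (suc r) * polyEulerNum k ν * e * M ^ℚ (p ∸ suc r)) E[p-1]≡0)
    (annihilate (binom p ν * binom (suc p ∸ ν) (suc r) * polyEulerNum k ν) (M ^ℚ (p ∸ suc r))))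
    where
    annihilate : ∀ a b → a * 0ℚ * b ≡ 0ℚ
    annihilate = solve-∀ ℚ-ring
  column-p : column p ≡ ℕtoℚ (suc p) * eulerNum p
  column-p = begin
      Σ< (suc p ∸ p) (λ ν → expansionTerm k p m ν p)
    ≡⟨ cong (λ n → Σ< n (λ ν → expansionTerm k p m ν p)) (ℕP.m+n∸n≡m 1 p) ⟩
      0ℚ + 1ℚ * binom (suc p) p * polyEulerNum k 0 * eulerNum p * M ^ℚ (p ∸ p)
    ≡⟨ cong₃ (λ b c e → 0ℚ + 1ℚ * b * c * eulerNum p * M ^ℚ e)
         (cong ℕtoℚ [1+p]Cp≡1+p) (polyEulerNum-0 k) (ℕP.n∸n≡0 p) ⟩
      0ℚ + 1ℚ * ℕtoℚ (suc p) * 1ℚ * eulerNum p * 1ℚ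
    ≡⟨ simplify (ℕtoℚ (suc p)) (eulerNum p) ⟩
      ℕtoℚ (suc p) * eulerNum p
    ∎
    where
    [1+p]Cp≡1+p : suc p C p ≡ suc p
    [1+p]Cp≡1+p = trans (nCk≡nC[n∸k] (ℕP.n≤1+n p)) (trans (cong (suc p C_) (ℕP.m+n∸n≡m 1 p)) (nC1≡n (suc p)))
    simplify : ∀ a e → 0ℚ + 1ℚ * a * 1ℚ * e * 1ℚ ≡ a * e
    simplify = solve-∀ ℚ-ring
  column-0 : column 0 ≡ M ^ℚ p * polyEulerPoly k p 1ℚ
  column-0 = sym (begin
      M ^ℚ p * polyEulerPoly k p 1ℚ
    ≡⟨ cong (M ^ℚ p *_) (polyEulerPoly-appell k 1ℚ p) ⟩
      M ^ℚ p * Σ< (suc p) (λ ν → binom p ν * polyEulerNum k ν * 1ℚ ^ℚ (p ∸ ν))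
    ≡⟨ *-distribˡ-Σ (suc p) (M ^ℚ p) _ ⟩
      Σ< (suc p) (λ ν → M ^ℚ p * (binom p ν * polyEulerNum k ν * 1ℚ ^ℚ (p ∸ ν)))
    ≡⟨ Σ-cong′ (suc p) (λ ν → trans (cong (λ z → M ^ℚ p * (binom p ν * polyEulerNum k ν * z)) (1^ℚ (p ∸ ν)))
         (regroup (M ^ℚ p) (binom p ν) (polyEulerNum k ν))) ⟩
      column 0
    ∎)
    where
    regroup : ∀ x b c → x * (b * c * 1ℚ) ≡ b * 1ℚ * c * 1ℚ * x
    regroup = solve-∀ ℚ-ring

double≡*2 : ∀ n → n ℕ.* 2 ≡ double n
double≡*2 zero    = refl
double≡*2 (suc n) = cong (λ z → suc (suc z)) (double≡*2 n)

odd⇒suc-double : ∀ n → n % 2 ≡ 1 → ∃ λ q → n ≡ suc (double q)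
odd⇒suc-double n n%2≡1 = n / 2 , trans (m≡m%n+[m/n]*n n 2) (cong₂ ℕ._+_ n%2≡1 (double≡*2 (n / 2)))

eulerNum-pred-odd : ∀ r → suc (suc r) % 2 ≡ 1 → eulerNum (suc r) ≡ 0ℚ
eulerNum-pred-odd r odd with odd⇒suc-double (suc (suc r)) odd
... | suc j , eq = subst (λ n → eulerNum n ≡ 0ℚ) (sym (ℕP.suc-injective eq)) (eulerNum-double j)

theorem11 : (k : ℤ) (m p : ℕ) → m % 2 ≡ 1 → 1 < p → p % 2 ≡ 1 →
    S k p m ≡
      Σ[ 1 ⋯ p ∸ 2 ] (λ i → Σ[ 0 ⋯ p ∸ i ] (λ ν →
          binom p ν ℚ.* binom (suc p ∸ ν) i ℚ.* polyEulerNum k ν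
            ℚ.* eulerNum i ℚ.* (ℕtoℚ m ^ℚ (p ∸ i))))
      ℚ.+ ℕtoℚ (suc p) ℚ.* eulerNum p
      ℚ.+ (ℕtoℚ m ^ℚ p) ℚ.* polyEulerPoly k p 1ℚ
theorem11 k m (suc (suc r)) m-odd (s≤s (s≤s _)) p-odd =
  trans (S-expansion k (suc (suc r)) (proj₂ (odd⇒suc-double m m-odd))) (expansion-columns k r m (eulerNum-pred-odd r p-odd))
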